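{- Let $r\ge 1$ and $k\ge 1$ be integers with $rk\ge 3$ and $k\neq 1$. Then $$E_k^r(x)=\Omega(x^{k-1}),$$ where $E_k^r(x)=V_k^r(x)-\dfrac{(2x)^k}{\zeta(rk)}$ and $V_k^r(x)$ is the number of relatively $r$-prime $k$-tuples of integers in $[-x,x]^k$.
   Context: For a fixed integer $r\ge 1$ and integers $x_1,\ldots,x_k$, not all zero, $(x_1,\ldots,x_k)_r$ denotes the largest positive integer $n$ such that $n^r$ divides every $x_i$. Thus $(x_1,\ldots,x_k)_r=1$ means that there is no prime $p$ such that $p^r$ divides all of $x_1,\ldots,x_k$; the tuple is then called relatively $r$-prime. The zero tuple is not relatively $r$-prime. For real $x>0$, $V_k^r(x)$ denotes the number of $k$-tuples of integers $(x_1,\ldots,x_k)$ with $(x_1,\ldots,x_k)_r=1$ and $|x_i|\le x$ for all $i=1,\ldots,k$. $\zeta$ is the Riemann zeta function. The symbol $\Omega$ is that of Hardy and Littlewood: $f(x)=\Omega(g(x))$ means $\limsup_{x\to\infty}\left|\frac{f(x)}{g(x)}\right|>0$. -}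

module Defs where

open import Data.Nat.Base as ℕ using (ℕ; zero; suc; z≤n; s≤s)
import Data.Nat.Properties as ℕ
open import Data.Integer.Base as ℤ using (ℤ; +_; +[1+_])
import Data.Integer.Properties as ℤ
open import Data.Integer.Divisibility using (_∣_)
open import Data.Rational.Base hiding (_>_; _≥_)
import Data.Rational.Unnormalised.Base as ℚᵘ
import Data.Rational.Unnormalised.Properties as ℚᵘ
open import Data.Rational.Properties
open import Data.Rational.Solver using (module +-*-Solver)
open +-*-Solver using (solve; _:+_; _:*_; :-_; _:-_; _:=_)
import Data.Nat.Solver
private module ℕSolver = Data.Nat.Solver.+-*-Solver
open import Data.List.Base using (List; length)
open import Data.List.Membership.Propositional using (_∈_)
open import Data.List.Relation.Unary.Unique.Propositional using (Unique)
open import Data.Vec.Base using (Vec)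
open import Data.Vec.Relation.Unary.All using (All)
open import Data.Product.Base using (Σ-syntax; ∃-syntax; _×_; _,_; proj₁; proj₂)
open import Data.Sum.Base using (_⊎_; inj₁; inj₂)
open import Function.Bundles using (_⇔_)
open import Relation.Nullary.Decidable.Core using (yes; no)
open import Relation.Nullary.Negation.Core using (¬_; contradiction)
open import Relation.Binary.PropositionalEquality
  using (_≡_; _≢_; refl; sym; trans; cong; cong₂; subst; subst₂)

-- Division by zero is given the value 0, so that a real can be inverted
-- termwise even if finitely many of its approximations vanish.
inv : ℚ → ℚ
inv q with q ≟ 0ℚ
... | yes _  = 0ℚ
... | no q≢0 = (1/ q) {{≢-nonZero q≢0}}

inv-inverseʳ : ∀ q → q ≢ 0ℚ → q * inv q ≡ 1ℚ
inv-inverseʳ q q≢0 with q ≟ 0ℚ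
... | yes q≡0 = contradiction q≡0 q≢0
... | no  q≢0 = *-inverseʳ q {{≢-nonZero q≢0}}

inv-positive : ∀ q → 0ℚ < q → 0ℚ < inv q
inv-positive q 0<q with q ≟ 0ℚ
... | yes q≡0 = contradiction (sym q≡0) (<⇒≢ 0<q)
... | no  _   = positive⁻¹ _ {{1/pos⇒pos q {{positive 0<q}}}}

*-positive : ∀ {p q} → 0ℚ < p → 0ℚ < q → 0ℚ < p * q
*-positive {p} {q} 0<p 0<q =
  positive⁻¹ _ {{pos*pos⇒pos p {{positive 0<p}} q {{positive 0<q}}}}

*-mono-≤-nonNeg : ∀ {p q r s} → 0ℚ ≤ r → 0ℚ ≤ q → p ≤ q → r ≤ s → p * r ≤ q * s
*-mono-≤-nonNeg {p} {q} {r} {s} 0≤r 0≤q p≤q r≤s = ≤-trans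
  (*-monoʳ-≤-nonNeg r {{nonNegative 0≤r}} p≤q)
  (*-monoˡ-≤-nonNeg q {{nonNegative 0≤q}} r≤s)

half : ℚ → ℚ
half ε = ½ * ε

half-positive : ∀ {ε} → 0ℚ < ε → 0ℚ < half ε
half-positive = *-positive (positive⁻¹ ½)

half+half : ∀ ε → half ε + half ε ≡ ε
half+half ε = trans (sym (*-distribʳ-+ ε ½ ½)) (*-identityˡ ε)

p≤∣p∣ : ∀ p → p ≤ ∣ p ∣
p≤∣p∣ p with ≤-total 0ℚ p
... | inj₁ 0≤p = ≤-reflexive (sym (0≤p⇒∣p∣≡p 0≤p))
... | inj₂ p≤0 = ≤-trans p≤0 (0≤∣p∣ p)

∣p-q∣≡∣q-p∣ : ∀ p q → ∣ p - q ∣ ≡ ∣ q - p ∣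
∣p-q∣≡∣q-p∣ p q = trans (sym (∣-p∣≡∣p∣ (p - q)))
  (cong ∣_∣ (solve 2 (λ p q → :- (p :- q) := q :- p) refl p q))

∣p∣≤∣p-q∣+∣q∣ : ∀ p q → ∣ p ∣ ≤ ∣ p - q ∣ + ∣ q ∣
∣p∣≤∣p-q∣+∣q∣ p q = subst (λ t → ∣ t ∣ ≤ ∣ p - q ∣ + ∣ q ∣)
  (solve 2 (λ p q → (p :- q) :+ q := p) refl p q) (∣p+q∣≤∣p∣+∣q∣ (p - q) q)

Cauchy : (ℕ → ℚ) → Set
Cauchy a = ∀ ε → 0ℚ < ε →
  ∃[ N ] (∀ m n → N ℕ.≤ m → N ℕ.≤ n → ∣ a m - a n ∣ < ε)

record ℝ : Set where
  constructor mkℝ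
  field
    seq    : ℕ → ℚ
    cauchy : Cauchy seq

open ℝ public

infixl 8 _^ℝ_
infixl 7 _*ℝ_ _÷ℝ_[_]
infixl 6 _+ℝ_ _-ℝ_
infix  4 _<ℝ_ _≤ℝ_

fromℚ : ℚ → ℝ
fromℚ q = mkℝ (λ _ → q) λ ε 0<ε →
  0 , λ _ _ _ _ → subst (_< ε) (sym (cong ∣_∣ (+-inverseʳ q))) 0<ε

fromℕ : ℕ → ℝ
fromℕ n = fromℚ (+ n / 1)

0ℝ 1ℝ : ℝ
0ℝ = fromℚ 0ℚ
1ℝ = fromℚ 1ℚ

_<ℝ_ : ℝ → ℝ → Set
x <ℝ y = ∃[ ε ] (0ℚ < ε × ∃[ N ] (∀ n → N ℕ.≤ n → seq x n + ε ≤ seq y n))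

_≤ℝ_ : ℝ → ℝ → Set
x ≤ℝ y = ¬ (y <ℝ x)

_#0 : ℝ → Set
x #0 = (x <ℝ 0ℝ) ⊎ (0ℝ <ℝ x)

_+ℝ_ : ℝ → ℝ → ℝ
mkℝ a ca +ℝ mkℝ b cb = mkℝ (λ n → a n + b n) λ ε 0<ε →
  let M , hM = ca (half ε) (half-positive 0<ε)
      N , hN = cb (half ε) (half-positive 0<ε)
  in M ℕ.⊔ N , λ m n p q →
    ≤-<-trans
      (subst (λ t → ∣ t ∣ ≤ ∣ a m - a n ∣ + ∣ b m - b n ∣)
        (solve 4 (λ x y z w → (x :- y) :+ (z :- w) := (x :+ z) :- (y :+ w))
          refl (a m) (a n) (b m) (b n))
        (∣p+q∣≤∣p∣+∣q∣ (a m - a n) (b m - b n)))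
      (subst (∣ a m - a n ∣ + ∣ b m - b n ∣ <_) (half+half ε)
        (+-mono-< (hM m n (ℕ.m⊔n≤o⇒m≤o M N p) (ℕ.m⊔n≤o⇒m≤o M N q))
                  (hN m n (ℕ.m⊔n≤o⇒n≤o M N p) (ℕ.m⊔n≤o⇒n≤o M N q))))

-ℝ_ : ℝ → ℝ
-ℝ mkℝ a ca = mkℝ (λ n → - a n) λ ε 0<ε →
  let N , hN = ca ε 0<ε
  in N , λ m n p q →
    subst (_< ε)
      (trans (sym (∣-p∣≡∣p∣ (a m - a n)))
             (cong ∣_∣ (neg-distrib-+ (a m) (- a n))))
      (hN m n p q)

_-ℝ_ : ℝ → ℝ → ℝ
x -ℝ y = x +ℝ (-ℝ y)

∣_∣ℝ : ℝ → ℝ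
∣ mkℝ a ca ∣ℝ = mkℝ (λ n → ∣ a n ∣) λ ε 0<ε →
  let N , hN = ca ε 0<ε
  in N , λ m n p q → ≤-<-trans (reverse-triangle (a m) (a n)) (hN m n p q)
  where
  step : ∀ p q → ∣ p ∣ - ∣ q ∣ ≤ ∣ p - q ∣
  step p q = subst (∣ p ∣ - ∣ q ∣ ≤_)
    (solve 2 (λ s t → (s :+ t) :- t := s) refl ∣ p - q ∣ ∣ q ∣)
    (+-monoˡ-≤ (- ∣ q ∣) (∣p∣≤∣p-q∣+∣q∣ p q))

  reverse-triangle : ∀ p q → ∣ ∣ p ∣ - ∣ q ∣ ∣ ≤ ∣ p - q ∣
  reverse-triangle p q with ∣p∣≡p∨∣p∣≡-p (∣ p ∣ - ∣ q ∣)
  ... | inj₁ eq = ≤-trans (≤-reflexive eq) (step p q)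
  ... | inj₂ eq = ≤-trans
    (≤-reflexive (trans eq
      (solve 2 (λ s t → :- (s :- t) := t :- s) refl ∣ p ∣ ∣ q ∣)))
    (≤-trans (step q p) (≤-reflexive (∣p-q∣≡∣q-p∣ q p)))

eventually-bounded : ∀ {a} → Cauchy a →
  ∃[ B ] (0ℚ < B × ∃[ N ] (∀ n → N ℕ.≤ n → ∣ a n ∣ ≤ B))
eventually-bounded {a} ca =
  let N , hN = ca 1ℚ (positive⁻¹ 1ℚ)
  in 1ℚ + ∣ a N ∣
   , positive⁻¹ _ {{pos+nonNeg⇒pos 1ℚ ∣ a N ∣ {{∣-∣-nonNeg (a N)}}}}
   , N
   , λ n p → ≤-trans (∣p∣≤∣p-q∣+∣q∣ (a n) (a N))
               (+-monoˡ-≤ ∣ a N ∣ (<⇒≤ (hN n N p ℕ.≤-refl)))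

_*ℝ_ : ℝ → ℝ → ℝ
mkℝ a ca *ℝ mkℝ b cb = mkℝ (λ n → a n * b n) λ ε 0<ε →
  let A , 0<A , M , hA = eventually-bounded ca
      B , 0<B , N , hB = eventually-bounded cb
      P , hP = ca (half ε * inv B) (*-positive (half-positive 0<ε) (inv-positive B 0<B))
      Q , hQ = cb (half ε * inv A) (*-positive (half-positive 0<ε) (inv-positive A 0<A))
      L = (M ℕ.⊔ N) ℕ.⊔ (P ℕ.⊔ Q)
      M≤ : ∀ {m} → L ℕ.≤ m → M ℕ.≤ m
      M≤ p = ℕ.m⊔n≤o⇒m≤o M N (ℕ.m⊔n≤o⇒m≤o (M ℕ.⊔ N) (P ℕ.⊔ Q) p)
      N≤ : ∀ {m} → L ℕ.≤ m → N ℕ.≤ m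
      N≤ p = ℕ.m⊔n≤o⇒n≤o M N (ℕ.m⊔n≤o⇒m≤o (M ℕ.⊔ N) (P ℕ.⊔ Q) p)
      P≤ : ∀ {m} → L ℕ.≤ m → P ℕ.≤ m
      P≤ p = ℕ.m⊔n≤o⇒m≤o P Q (ℕ.m⊔n≤o⇒n≤o (M ℕ.⊔ N) (P ℕ.⊔ Q) p)
      Q≤ : ∀ {m} → L ℕ.≤ m → Q ℕ.≤ m
      Q≤ p = ℕ.m⊔n≤o⇒n≤o P Q (ℕ.m⊔n≤o⇒n≤o (M ℕ.⊔ N) (P ℕ.⊔ Q) p)
  in L , λ m n p q →
    ≤-<-trans
      (subst (λ t → ∣ t ∣ ≤ ∣ a m - a n ∣ * ∣ b m ∣ + ∣ b m - b n ∣ * ∣ a n ∣)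
        (solve 4 (λ x y z w → (x :- y) :* z :+ (z :- w) :* y := x :* z :- y :* w)
          refl (a m) (a n) (b m) (b n))
        (≤-trans
          (∣p+q∣≤∣p∣+∣q∣ ((a m - a n) * b m) ((b m - b n) * a n))
          (≤-reflexive (cong₂ _+_ (∣p*q∣≡∣p∣*∣q∣ (a m - a n) (b m))
                                  (∣p*q∣≡∣p∣*∣q∣ (b m - b n) (a n))))))
      (subst (∣ a m - a n ∣ * ∣ b m ∣ + ∣ b m - b n ∣ * ∣ a n ∣ <_) (half+half ε)
        (+-mono-<
          (bound (half ε) 0<B (hP m n (P≤ p) (P≤ q)) (hB m (N≤ p)))
          (bound (half ε) 0<A (hQ m n (Q≤ p) (Q≤ q)) (hA n (M≤ q)))))
  where
  bound : ∀ {u v} ε {C} → 0ℚ < C → ∣ u ∣ < ε * inv C → ∣ v ∣ ≤ C → ∣ u ∣ * ∣ v ∣ < ε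
  bound {u} {v} ε {C} 0<C u< v≤ = ≤-<-trans
    (*-monoˡ-≤-nonNeg ∣ u ∣ {{∣-∣-nonNeg u}} v≤)
    (subst (∣ u ∣ * C <_)
      (trans (*-assoc ε (inv C) C)
        (trans (cong (ε *_) (trans (*-comm (inv C) C)
                              (inv-inverseʳ C (λ C≡0 → <⇒≢ 0<C (sym C≡0)))))
               (*-identityʳ ε)))
      (*-monoˡ-<-pos C {{positive 0<C}} u<))

_^ℝ_ : ℝ → ℕ → ℝ
x ^ℝ zero  = 1ℝ
x ^ℝ suc n = x *ℝ (x ^ℝ n)

eventually-apart : ∀ {x} → x #0 →
  ∃[ δ ] (0ℚ < δ × ∃[ N ] (∀ n → N ℕ.≤ n → δ ≤ ∣ seq x n ∣))
eventually-apart {x} (inj₁ (δ , 0<δ , N , h)) = δ , 0<δ , N , λ n p →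
  ≤-trans
    (subst₂ _≤_ (solve 2 (λ s t → (s :+ t) :- s := t) refl (seq x n) δ)
                (+-identityˡ (- seq x n))
      (+-monoˡ-≤ (- seq x n) (h n p)))
    (≤-trans (p≤∣p∣ (- seq x n)) (≤-reflexive (∣-p∣≡∣p∣ (seq x n))))
eventually-apart {x} (inj₂ (δ , 0<δ , N , h)) = δ , 0<δ , N , λ n p →
  ≤-trans (≤-trans (≤-reflexive (sym (+-identityˡ δ))) (h n p)) (p≤∣p∣ (seq x n))

inverse : (x : ℝ) → x #0 → ℝ
inverse x x#0 = mkℝ (λ n → inv (a n)) λ ε 0<ε →
  let δ , 0<δ , M , hδ = eventually-apart {x} x#0
      N , hN = cauchy x (ε * (δ * δ)) (*-positive 0<ε (*-positive 0<δ 0<δ))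
  in M ℕ.⊔ N , λ m n p q →
    close 0<ε 0<δ (hδ m (ℕ.m⊔n≤o⇒m≤o M N p)) (hδ n (ℕ.m⊔n≤o⇒m≤o M N q))
      (hN m n (ℕ.m⊔n≤o⇒n≤o M N p) (ℕ.m⊔n≤o⇒n≤o M N q))
  where
  a = seq x

  nonzero : ∀ {δ p} → 0ℚ < δ → δ ≤ ∣ p ∣ → p ≢ 0ℚ
  nonzero 0<δ δ≤ refl = <-irrefl refl (<-≤-trans 0<δ δ≤)

  close : ∀ {ε δ p q} → 0ℚ < ε → 0ℚ < δ → δ ≤ ∣ p ∣ → δ ≤ ∣ q ∣ →
          ∣ p - q ∣ < ε * (δ * δ) → ∣ inv p - inv q ∣ < ε
  close {ε} {δ} {p} {q} 0<ε 0<δ δ≤p δ≤q h =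
    *-cancelʳ-<-nonNeg ∣ p * q ∣ {{∣-∣-nonNeg (p * q)}}
      (subst (_< ε * ∣ p * q ∣) (sym difference)
        (<-≤-trans h
          (*-monoˡ-≤-nonNeg ε {{pos⇒nonNeg ε {{positive 0<ε}}}}
            (≤-trans (*-mono-≤-nonNeg (<⇒≤ 0<δ) (0≤∣p∣ p) δ≤p δ≤q)
                     (≤-reflexive (sym (∣p*q∣≡∣p∣*∣q∣ p q)))))))
    where
    cross : (inv p - inv q) * (p * q) ≡ q - p
    cross = trans
      (solve 4 (λ p q i j → (i :- j) :* (p :* q) := (p :* i) :* q :- (q :* j) :* p)
        refl p q (inv p) (inv q))
      (trans
        (cong₂ (λ s t → s * q - t * p) (inv-inverseʳ p (nonzero 0<δ δ≤p))
                                       (inv-inverseʳ q (nonzero 0<δ δ≤q)))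
        (cong₂ _-_ (*-identityˡ q) (*-identityˡ p)))

    difference : ∣ inv p - inv q ∣ * ∣ p * q ∣ ≡ ∣ p - q ∣
    difference = trans (sym (∣p*q∣≡∣p∣*∣q∣ (inv p - inv q) (p * q)))
      (trans (cong ∣_∣ cross) (∣p-q∣≡∣q-p∣ q p))

_÷ℝ_[_] : ℝ → (y : ℝ) → y #0 → ℝ
x ÷ℝ y [ y#0 ] = x *ℝ inverse y y#0

reciprocalPower : ℕ → ℕ → ℚ
reciprocalPower s n = (+ 1 / (suc n ℕ.^ s)) {{ℕ.m^n≢0 (suc n) s}}

-- zetaSum s n = 1/1ˢ + 1/2ˢ + ⋯ + 1/nˢ
zetaSum : ℕ → ℕ → ℚ
zetaSum s zero    = 0ℚ
zetaSum s (suc n) = zetaSum s n + reciprocalPower s n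

unitFraction-antimono : ∀ {a b} .{{_ : ℕ.NonZero a}} .{{_ : ℕ.NonZero b}} →
                        a ℕ.≤ b → + 1 / b ≤ + 1 / a
unitFraction-antimono {suc a} {suc b} a≤b = toℚᵘ-cancel-≤
  (ℚᵘ.≤-respʳ-≃ (ℚᵘ.≃-sym (toℚᵘ-fromℚᵘ (ℚᵘ.mkℚᵘ (+ 1) a)))
    (ℚᵘ.≤-respˡ-≃ (ℚᵘ.≃-sym (toℚᵘ-fromℚᵘ (ℚᵘ.mkℚᵘ (+ 1) b)))
      (ℚᵘ.*≤* (subst₂ ℤ._≤_ (sym (ℤ.*-identityˡ (+ suc a)))
                            (sym (ℤ.*-identityˡ (+ suc b)))
                            (ℤ.+≤+ a≤b)))))

unitFraction-positive : ∀ n .{{_ : ℕ.NonZero n}} → 0ℚ < + 1 / n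
unitFraction-positive n = positive⁻¹ _ {{normalize-pos 1 n}}

unitFraction-split : ∀ n →
  + 1 / (suc n ℕ.* suc (suc n)) + + 1 / suc (suc n) ≡ + 1 / suc n
unitFraction-split n = toℚᵘ-injective
  (ℚᵘ.≃-trans (toℚᵘ-homo-+ (+ 1 / (suc n ℕ.* suc (suc n))) (+ 1 / suc (suc n)))
  (ℚᵘ.≃-trans
    (ℚᵘ.+-cong (toℚᵘ-fromℚᵘ (ℚᵘ.mkℚᵘ (+ 1) (suc n ℕ.+ n ℕ.* suc (suc n))))
               (toℚᵘ-fromℚᵘ (ℚᵘ.mkℚᵘ (+ 1) (suc n))))
  (ℚᵘ.≃-trans
    (ℚᵘ.*≡* (cong +_ (ℕSolver.solve 1
      (λ m → let a = ℕSolver.con 1 ℕSolver.:+ m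
                 b = ℕSolver.con 2 ℕSolver.:+ m
             in (ℕSolver.con 1 ℕSolver.:* b ℕSolver.:+ ℕSolver.con 1 ℕSolver.:* (a ℕSolver.:* b)) ℕSolver.:* a
                ℕSolver.:= ℕSolver.con 1 ℕSolver.:* (a ℕSolver.:* b ℕSolver.:* b))
      refl n)))
    (ℚᵘ.≃-sym (toℚᵘ-fromℚᵘ (ℚᵘ.mkℚᵘ (+ 1) n))))))

unitFraction-small : ∀ ε → 0ℚ < ε → ∃[ n ] (+ 1 / suc n < ε)
unitFraction-small (mkℚ +[1+ p ] d c) 0<ε = suc d , toℚᵘ-cancel-<
  (ℚᵘ.<-respˡ-≃ (ℚᵘ.≃-sym (toℚᵘ-fromℚᵘ (ℚᵘ.mkℚᵘ (+ 1) (suc d))))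
    (ℚᵘ.*<* (subst₂ ℤ._<_ (sym (ℤ.*-identityˡ (+ suc d))) refl
      (ℤ.+<+ (ℕ.≤-trans (ℕ.≤-reflexive (sym (ℕ.*-identityˡ (suc (suc d)))))
                        (ℕ.*-monoˡ-≤ (suc (suc d)) (s≤s (z≤n {p}))))))))
unitFraction-small (mkℚ (+ 0) d c) 0<ε = contradiction (positive 0<ε) λ ()
unitFraction-small (mkℚ (ℤ.-[1+ _ ]) d c) 0<ε = contradiction (positive 0<ε) λ ()

zetaSum-step : ∀ s n → zetaSum s n ≤ zetaSum s (suc n)
zetaSum-step s n = subst (_≤ zetaSum s (suc n)) (+-identityʳ (zetaSum s n))
  (+-monoʳ-≤ (zetaSum s n)
    (<⇒≤ (unitFraction-positive (suc n ℕ.^ s) {{ℕ.m^n≢0 (suc n) s}})))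

zetaSum-mono : ∀ s {m n} → m ℕ.≤ n → zetaSum s m ≤ zetaSum s n
zetaSum-mono s {m} {n} m≤n =
  subst (λ t → zetaSum s m ≤ zetaSum s t) (ℕ.m∸n+n≡m m≤n) (go (n ℕ.∸ m))
  where
  go : ∀ d → zetaSum s m ≤ zetaSum s (d ℕ.+ m)
  go zero    = ≤-refl
  go (suc d) = ≤-trans (go d) (zetaSum-step s (d ℕ.+ m))

-- zetaSum s n + 1/n decreases in n ≥ 1, since 1/(n+1)ˢ ≤ 1/n − 1/(n+1).
zetaUpper : ℕ → ℕ → ℚ
zetaUpper s n = zetaSum s (suc n) + + 1 / suc n

zetaUpper-step : ∀ s → 1 ℕ.< s → ∀ n → zetaUpper s (suc n) ≤ zetaUpper s n
zetaUpper-step s 1<s n = subst (_≤ zetaUpper s n)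
  (sym (+-assoc (zetaSum s (suc n)) (reciprocalPower s (suc n)) (+ 1 / suc (suc n))))
  (+-monoʳ-≤ (zetaSum s (suc n))
    (≤-trans
      (+-monoˡ-≤ (+ 1 / suc (suc n))
        (unitFraction-antimono {{_}} {{ℕ.m^n≢0 (suc (suc n)) s}}
          (ℕ.≤-trans (ℕ.*-monoˡ-≤ (suc (suc n)) (ℕ.n≤1+n (suc n)))
          (ℕ.≤-trans (ℕ.≤-reflexive (cong (suc (suc n) ℕ.*_)
                                     (sym (ℕ.*-identityʳ (suc (suc n))))))
                     (ℕ.^-monoʳ-≤ (suc (suc n)) 1<s)))))
      (≤-reflexive (unitFraction-split n))))

zetaUpper-antimono : ∀ s → 1 ℕ.< s → ∀ {m n} → m ℕ.≤ n → zetaUpper s n ≤ zetaUpper s m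
zetaUpper-antimono s 1<s {m} {n} m≤n =
  subst (λ t → zetaUpper s t ≤ zetaUpper s m) (ℕ.m∸n+n≡m m≤n) (go (n ℕ.∸ m))
  where
  go : ∀ d → zetaUpper s (d ℕ.+ m) ≤ zetaUpper s m
  go zero    = ≤-refl
  go (suc d) = ≤-trans (zetaUpper-step s 1<s (d ℕ.+ m)) (go d)

zetaSum-bounded : ∀ s → 1 ℕ.< s → ∀ {m n} → suc m ℕ.≤ n → zetaSum s n ≤ zetaUpper s m
zetaSum-bounded s 1<s {m} {suc n} (s≤s m≤n) = ≤-trans
  (subst (_≤ zetaUpper s n) (+-identityʳ (zetaSum s (suc n)))
    (+-monoʳ-≤ (zetaSum s (suc n)) (<⇒≤ (unitFraction-positive (suc n)))))
  (zetaUpper-antimono s 1<s m≤n)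

interval-close : ∀ {l p q d} → l ≤ p → p ≤ l + d → l ≤ q → q ≤ l + d → ∣ p - q ∣ ≤ d
interval-close {l} {p} {q} {d} l≤p p≤ l≤q q≤ with ∣p∣≡p∨∣p∣≡-p (p - q)
... | inj₁ eq = ≤-trans (≤-reflexive eq)
                (≤-trans (+-mono-≤ p≤ (neg-antimono-≤ l≤q))
                  (≤-reflexive (solve 2 (λ l d → (l :+ d) :- l := d) refl l d)))
... | inj₂ eq = ≤-trans (≤-reflexive (trans eq
                  (solve 2 (λ p q → :- (p :- q) := q :- p) refl p q)))
                (≤-trans (+-mono-≤ q≤ (neg-antimono-≤ l≤p))
                  (≤-reflexive (solve 2 (λ l d → (l :+ d) :- l := d) refl l d)))

ζ : (s : ℕ) → 1 ℕ.< s → ℝ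
ζ s 1<s = mkℝ (zetaSum s) λ ε 0<ε →
  let K , 1/K<ε = unitFraction-small ε 0<ε
  in suc K , λ m n p q → ≤-<-trans
    (interval-close (zetaSum-mono s p) (zetaSum-bounded s 1<s p)
                    (zetaSum-mono s q) (zetaSum-bounded s 1<s q))
    1/K<ε

ζ#0 : ∀ s (1<s : 1 ℕ.< s) → ζ s 1<s #0
ζ#0 s 1<s = inj₂ (zetaSum s 1 , 0<zetaSum , 1 , λ n 1≤n →
  subst (_≤ zetaSum s n) (sym (+-identityˡ (zetaSum s 1))) (zetaSum-mono s 1≤n))
  where
  0<zetaSum : 0ℚ < zetaSum s 1
  0<zetaSum = subst (0ℚ <_) (sym (+-identityˡ (reciprocalPower s 0)))
    (unitFraction-positive (1 ℕ.^ s) {{ℕ.m^n≢0 1 s}})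

-- (x₁,…,x_k)_r = n.  For r ≥ 1 no n satisfies this when all xᵢ vanish.
IsGcd : ∀ {k} → ℕ → Vec ℤ k → ℕ → Set
IsGcd r xs n =
  1 ℕ.≤ n × All (λ x → + (n ℕ.^ r) ∣ x) xs ×
  (∀ m → 1 ℕ.≤ m → All (λ x → + (m ℕ.^ r) ∣ x) xs → m ℕ.≤ n)

RelativelyPrime : ∀ {k} → ℕ → Vec ℤ k → Set
RelativelyPrime r xs = IsGcd r xs 1

PrimeTupleIn : (r k : ℕ) → ℝ → Vec ℤ k → Set
PrimeTupleIn r k x xs =
  RelativelyPrime r xs × All (λ a → fromℕ ℤ.∣ a ∣ ≤ℝ x) xs

record Enumeration {A : Set} (P : A → Set) : Set where
  field
    elements : List A
    unique   : Unique elements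
    complete : ∀ a → a ∈ elements ⇔ P a

  card : ℕ
  card = length elements

-- V and E are functions of a real x > 0.  As ⌊x⌋ cannot be computed from a
-- Cauchy sequence, they also take an enumeration of the tuples counted;
-- their values do not depend on its choice, and classically it always exists.
Domain : (r k : ℕ) → ℝ → Set
Domain r k x = 0ℝ <ℝ x × Enumeration (PrimeTupleIn r k x)

V : (r k : ℕ) (x : ℝ) → Domain r k x → ℕ
V r k x (_ , e) = Enumeration.card e

E : (r k : ℕ) → 1 ℕ.< r ℕ.* k → (x : ℝ) → Domain r k x → ℝ
E r k 1<rk x d =
  fromℕ (V r k x d) -ℝ
  (fromℕ 2 *ℝ x) ^ℝ k ÷ℝ ζ (r ℕ.* k) 1<rk [ ζ#0 (r ℕ.* k) 1<rk ]

-- lim sup_{x→∞} ∣f x / g x∣ > 0 for f with domain D, unfolded as: for some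
-- c > 0, every tail x ≥ X contains a point at which the quotient exceeds c.
Ω : (D : ℝ → Set) → (∀ x → D x → ℝ) → (ℝ → ℝ) → Set
Ω D f g =
  ∃[ c ] (0ℝ <ℝ c × (∀ X →
    ∃[ x ] (X ≤ℝ x × Σ[ d ∈ D x ] Σ[ g#0 ∈ g x #0 ]
      c <ℝ ∣ f x d ÷ℝ g x [ g#0 ] ∣ℝ)))

{-# OPTIONS --safe #-}

-- The count V is constant for x in [n, n + 1), whereas (2x)ᵏ/ζ(rk) grows by at
-- least (2n + 1)ᵏ⁻¹/ζ(rk) between n and n + ½.  So for every n ≥ 1 the error is
-- of order xᵏ⁻¹ at one of these two points.  To locate that point constructively
-- both quotients are compared at a sufficiently late rational approximation.
module Submission where

open import Defs
open import Data.Nat.Base using (ℕ; _*_; _∸_; _≤_)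
open import Data.Nat.Properties using (<⇒≤)
open import Relation.Binary.PropositionalEquality using (_≢_)

open import Data.Nat.Base as ℕ using (zero; suc; z≤n; s≤s)
import Data.Nat.Divisibility as ℕ
import Data.Nat.Properties as ℕ
open import Data.Integer.Base as ℤ using (ℤ; +_; -[1+_])
import Data.Integer.Divisibility as ℤ
import Data.Integer.Properties as ℤ
open import Data.Rational.Base as ℚ using (ℚ; 0ℚ; 1ℚ; ½; _/_)
import Data.Rational.Properties as ℚ
import Data.Rational.Unnormalised.Base as ℚᵘ
import Data.Rational.Unnormalised.Properties as ℚᵘ
open import Data.Rational.Solver using (module +-*-Solver)
open +-*-Solver using (solve; con; _:+_; _:*_; _:-_; _:=_)
open import Algebra.Definitions.RawSemiring ℚ.+-*-rawSemiring using (_^_)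
open import Data.List.Base as List using (List; _++_; upTo; filter; cartesianProductWith)
open import Data.List.Membership.Propositional using (_∈_)
open import Data.List.Membership.Propositional.Properties
  using ( ∈-map⁺; ∈-map⁻; ∈-++⁺ˡ; ∈-++⁺ʳ; ∈-++⁻; ∈-upTo⁺; ∈-upTo⁻; ∈-filter⁺; ∈-filter⁻
        ; ∈-cartesianProductWith⁺; ∈-cartesianProductWith⁻ )
open import Data.List.Relation.Unary.Any using (here)
import Data.List.Relation.Unary.All as ListAll
import Data.List.Relation.Unary.AllPairs as AllPairs
import Data.List.Relation.Unary.Unique.Propositional.Properties as Unique
open import Data.Vec.Base using (Vec; []; _∷_)
open import Data.Vec.Properties using (∷-injective)
open import Data.Vec.Relation.Unary.All as All using (All; []; _∷_; all?)
import Data.Vec.Relation.Unary.Any as Any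
open import Data.Product.Base using (∃-syntax; _×_; _,_)
open import Data.Sum.Base using (_⊎_; inj₁; inj₂; [_,_]′)
import Data.Sum.Base as Sum
open import Function.Base using (_∘_)
open import Function.Bundles using (_⇔_; mk⇔; Equivalence)
open import Relation.Nullary.Decidable using (yes; no; map′; _→-dec_)
open import Relation.Nullary.Negation using (¬_; contradiction)
open import Relation.Unary using (Decidable)
open import Relation.Binary.PropositionalEquality
  using (_≡_; refl; sym; trans; cong; cong₂; subst; subst₂)

open Equivalence using (to; from)
open Enumeration

-- Finite enumerations and integer boxes.

Enumeration-cong : {A : Set} {P Q : A → Set} → (∀ a → P a ⇔ Q a) →
                   Enumeration P → Enumeration Q
Enumeration-cong P⇔Q e = record
  { elements = elements e
  ; unique   = unique e
  ; complete = λ a → mk⇔ (to (P⇔Q a) ∘ to (complete e a))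
                         (from (complete e a) ∘ from (P⇔Q a))
  }

Enumeration-filter : {A : Set} {P Q : A → Set} → Decidable Q →
                     Enumeration P → Enumeration (λ a → Q a × P a)
Enumeration-filter Q? e = record
  { elements = filter Q? (elements e)
  ; unique   = Unique.filter⁺ Q? (unique e)
  ; complete = λ a → mk⇔
      (λ a∈ → let a∈e , Qa = ∈-filter⁻ Q? a∈ in Qa , to (complete e a) a∈e)
      (λ (Qa , Pa) → ∈-filter⁺ Q? (from (complete e a) Pa) Qa)
  }

Enumeration-All : {A : Set} {P : A → Set} → Enumeration P →
                  ∀ k → Enumeration (All P {k})
Enumeration-All e zero = record
  { elements = List.[ [] ]
  ; unique   = ListAll.[] AllPairs.∷ AllPairs.[]
  ; complete = λ { [] → mk⇔ (λ _ → []) (λ _ → here refl) }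
  }
Enumeration-All {P = P} e (suc k) = record
  { elements = cartesianProductWith _∷_ (elements e) (elements es)
  ; unique   = Unique.cartesianProductWith⁺ _∷_ ∷-injective (unique e) (unique es)
  ; complete = λ { (a ∷ as) → mk⇔ (sound (a ∷ as))
      (λ { (Pa ∷ Pas) → ∈-cartesianProductWith⁺ _∷_ (from (complete e a) Pa)
                                                    (from (complete es as) Pas) }) }
  }
  where
  es = Enumeration-All e k

  sound : ∀ as → as ∈ cartesianProductWith _∷_ (elements e) (elements es) → All P as
  sound _ as∈ with ∈-cartesianProductWith⁻ _∷_ (elements e) (elements es) as∈
  ... | a , as , a∈ , as∈′ , refl = to (complete e a) a∈ ∷ to (complete es as) as∈′

Enumeration-interval : ∀ n → Enumeration (λ a → ℤ.∣ a ∣ ≤ n)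
Enumeration-interval n = record
  -- The lists have different lengths because `-[1+ m ]` stands for -(m + 1): the first runs over 0,
  -- ..., n and the second over -1, ..., -n.
  { elements = List.map +_ (upTo (suc n)) ++ List.map -[1+_] (upTo n)
  ; unique   = Unique.++⁺ (Unique.map⁺ ℤ.+-injective (Unique.upTo⁺ (suc n)))
                          (Unique.map⁺ ℤ.-[1+-injective (Unique.upTo⁺ n))
                          disjoint
  ; complete = λ a → mk⇔
      ([ nonNegative⇒≤ , negative⇒≤ ]′ ∘ ∈-++⁻ (List.map +_ (upTo (suc n))))
      (≤⇒∈ a)
  }
  where
  disjoint : ∀ {a} → ¬ (a ∈ List.map +_ (upTo (suc n)) × a ∈ List.map -[1+_] (upTo n))
  disjoint (p , q) with ∈-map⁻ +_ p | ∈-map⁻ -[1+_] q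
  ... | _ , _ , refl | _ , _ , ()

  nonNegative⇒≤ : ∀ {a} → a ∈ List.map +_ (upTo (suc n)) → ℤ.∣ a ∣ ≤ n
  nonNegative⇒≤ p with ∈-map⁻ +_ p
  ... | _ , m∈ , refl = ℕ.s≤s⁻¹ (∈-upTo⁻ m∈)

  negative⇒≤ : ∀ {a} → a ∈ List.map -[1+_] (upTo n) → ℤ.∣ a ∣ ≤ n
  negative⇒≤ p with ∈-map⁻ -[1+_] p
  ... | _ , m∈ , refl = ∈-upTo⁻ m∈

  ≤⇒∈ : ∀ a → ℤ.∣ a ∣ ≤ n → a ∈ List.map +_ (upTo (suc n)) ++ List.map -[1+_] (upTo n)
  ≤⇒∈ (+ m)    m≤n = ∈-++⁺ˡ (∈-map⁺ +_ (∈-upTo⁺ (s≤s m≤n)))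
  ≤⇒∈ -[1+ m ] m<n = ∈-++⁺ʳ (List.map +_ (upTo (suc n))) (∈-map⁺ -[1+_] (∈-upTo⁺ m<n))

-- Deciding relative r-primality.

m≤m^n : ∀ m {n} → 1 ≤ n → m ≤ m ℕ.^ n
m≤m^n zero    _   = z≤n
m≤m^n (suc m) {n} 1≤n = subst (_≤ suc m ℕ.^ n) (ℕ.*-identityʳ (suc m))
                      (ℕ.^-monoʳ-≤ (suc m) {1} {n} 1≤n)

-- A nonzero entry y leaves only finitely many candidates: if m ^ r divides y and r ≥ 1, then m ≤ m
-- ^ r ≤ |y|. A tuple without a nonzero entry is rejected outright.
relativelyPrime? : ∀ r → 1 ≤ r → ∀ {k} → Decidable (RelativelyPrime {k} r)
relativelyPrime? r 1≤r xs with All.decide zero? xs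
  where
  zero? : ∀ x → (ℤ.∣ x ∣ ≡ 0) ⊎ ℕ.NonZero ℤ.∣ x ∣
  zero? x with ℤ.∣ x ∣
  ... | zero  = inj₁ refl
  ... | suc _ = inj₂ _
... | inj₁ allZero = no λ (_ , _ , largest) →
  -- Every power divides 0, so 2 already refutes the maximality of 1.
  ℕ.<⇒≱ ℕ.≤-refl (largest 2 (s≤s z≤n)
    (All.map (λ x≡0 → subst (2 ℕ.^ r ℕ.∣_) (sym x≡0) ((2 ℕ.^ r) ℕ.∣0)) allZero))
... | inj₂ someNonZero = map′
  (λ bounded → s≤s z≤n
    , All.universal (λ x → subst (ℕ._∣ ℤ.∣ x ∣) (sym (ℕ.^-zeroˡ r)) (ℕ.1∣ _)) xs
    , λ m 1≤m m∣ → bounded (s≤s (divisor-bounded m m∣)) 1≤m m∣)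
  (λ (_ , _ , largest) {m} _ → largest m)
  (ℕ.allUpTo? (λ m → 1 ℕ.≤? m →-dec (all? (λ x → m ℕ.^ r ℕ.∣? ℤ.∣ x ∣) xs →-dec m ℕ.≤? 1))
              -- `allUpTo?` tests strictly below its bound, and m = |y| must still be tested.
              (suc ℤ.∣ Any.lookup someNonZero ∣))
  where
  divisor-bounded : ∀ m → All (λ x → + (m ℕ.^ r) ℤ.∣ x) xs → m ≤ ℤ.∣ Any.lookup someNonZero ∣
  divisor-bounded m m∣ =
    let mʳ∣y , y≢0 = All.lookupAny m∣ someNonZero
    in ℕ.≤-trans (m≤m^n m 1≤r) (ℕ.∣⇒≤ {{y≢0}} mʳ∣y)

-- Integer parts of rational points and the counts there.

fromℕ-mono-≤ : ∀ {m n} → m ≤ n → + m / 1 ℚ.≤ + n / 1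
fromℕ-mono-≤ {m} {n} m≤n = ℚ.toℚᵘ-cancel-≤
  (ℚᵘ.≤-respʳ-≃ (ℚᵘ.≃-sym (ℚ.toℚᵘ-fromℚᵘ (ℚᵘ.mkℚᵘ (+ n) 0)))
    (ℚᵘ.≤-respˡ-≃ (ℚᵘ.≃-sym (ℚ.toℚᵘ-fromℚᵘ (ℚᵘ.mkℚᵘ (+ m) 0)))
      (ℚᵘ.*≤* (ℤ.*-monoʳ-≤-nonNeg (+ 1) (ℤ.+≤+ m≤n)))))

fromℕ-suc : ∀ n → + n / 1 ℚ.+ 1ℚ ≡ + suc n / 1
fromℕ-suc n = ℚ.toℚᵘ-injective
  (ℚᵘ.≃-trans (ℚ.toℚᵘ-homo-+ (+ n / 1) 1ℚ)
  (ℚᵘ.≃-trans (ℚᵘ.+-congˡ (ℚ.toℚᵘ 1ℚ) (ℚ.toℚᵘ-fromℚᵘ (ℚᵘ.mkℚᵘ (+ n) 0)))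
  (ℚᵘ.≃-trans (ℚᵘ.*≡* (cong (ℤ._* + 1)
                (trans (cong (ℤ._+ + 1) (ℤ.*-identityʳ (+ n))) (cong +_ (ℕ.+-comm n 1)))))
              (ℚᵘ.≃-sym (ℚ.toℚᵘ-fromℚᵘ (ℚᵘ.mkℚᵘ (+ suc n) 0))))))

i≤+∣i∣ : ∀ i → i ℤ.≤ + ℤ.∣ i ∣
i≤+∣i∣ (+ n)    = ℤ.≤-refl
i≤+∣i∣ -[1+ n ] = ℤ.-≤+

-- The absolute value of the numerator already dominates the fraction. The successor makes the bound
-- positive, so that it can itself serve as a point x > 0.
archimedean : ∀ q → ∃[ n ] q ℚ.≤ + suc n / 1
archimedean q@(ℚ.mkℚ p d _) = ℤ.∣ p ∣ , ℚ.toℚᵘ-cancel-≤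
  (ℚᵘ.≤-respʳ-≃ (ℚᵘ.≃-sym (ℚ.toℚᵘ-fromℚᵘ (ℚᵘ.mkℚᵘ (+ suc ℤ.∣ p ∣) 0)))
    (ℚᵘ.*≤* (ℤ.≤-trans (ℤ.≤-reflexive (ℤ.*-identityʳ p))
      (ℤ.≤-trans (i≤+∣i∣ p)
        (ℤ.+≤+ (ℕ.≤-trans (ℕ.n≤1+n ℤ.∣ p ∣) (ℕ.m≤m*n (suc ℤ.∣ p ∣) (suc d))))))))

IsFloor : ℕ → ℚ → Set
IsFloor n q = + n / 1 ℚ.≤ q × q ℚ.< + suc n / 1

-- Reduces the negatively defined order on reals to the decidable order on naturals, which makes the
-- tuples up to a rational point enumerable.
fromℕ≤⇔≤floor : ∀ {n q} → IsFloor n q → ∀ m → (fromℕ m ≤ℝ fromℚ q) ⇔ m ≤ n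
fromℕ≤⇔≤floor {n} {q} (n≤q , q<1+n) m = mk⇔ ⇒ ⇐
  where
  ⇒ : fromℕ m ≤ℝ fromℚ q → m ≤ n
  ⇒ m≤q with m ℕ.≤? n
  ... | yes m≤n = m≤n
  ... | no  m≰n = contradiction
    -- The margin m - q witnesses q < m; it is positive since q < n + 1 ≤ m.
    ( + m / 1 ℚ.- q
    , ℚ.<-respˡ-≡ (ℚ.+-inverseʳ q)
        (ℚ.+-monoˡ-< (ℚ.- q) (ℚ.<-≤-trans q<1+n (fromℕ-mono-≤ (ℕ.≰⇒> m≰n))))
    , 0
    , λ _ _ → ℚ.≤-reflexive
        (solve 2 (λ q m → q :+ (m :- q) := m) refl q (+ m / 1)) )
    m≤q

  ⇐ : m ≤ n → fromℕ m ≤ℝ fromℚ q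
  ⇐ m≤n (ε , 0<ε , N , h) = ℚ.<-irrefl refl (ℚ.<-≤-trans
    (ℚ.<-respˡ-≡ (ℚ.+-identityʳ q) (ℚ.+-monoʳ-< q 0<ε))
    (ℚ.≤-trans (h N ℕ.≤-refl) (ℚ.≤-trans (fromℕ-mono-≤ m≤n) n≤q)))

enumeratePrimeTuples : ∀ r k → 1 ≤ r → ∀ n →
  Enumeration (λ (xs : Vec ℤ k) → RelativelyPrime r xs × All (λ a → ℤ.∣ a ∣ ≤ n) xs)
enumeratePrimeTuples r k 1≤r n =
  Enumeration-filter (relativelyPrime? r 1≤r) (Enumeration-All (Enumeration-interval n) k)

-- The underlying list depends on n only, so two points with the same integer part receive
-- definitionally equal counts.
floorDomain : ∀ r k → 1 ≤ r → ∀ n {q} → 0ℚ ℚ.< q → IsFloor n q → Domain r k (fromℚ q)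
floorDomain r k 1≤r n {q} 0<q floor =
    (q , 0<q , 0 , λ _ _ → ℚ.≤-reflexive (ℚ.+-identityˡ q))
  , Enumeration-cong
      (λ xs → mk⇔ (λ (rp , b) → rp , All.map (from (fromℕ≤⇔≤floor floor _)) b)
                  (λ (rp , b) → rp , All.map (to (fromℕ≤⇔≤floor floor _)) b))
      (enumeratePrimeTuples r k 1≤r n)

-- The jump of the error quotient over half a unit, at rational approximations.

p≤p+q : ∀ p {q} → 0ℚ ℚ.≤ q → p ℚ.≤ p ℚ.+ q
p≤p+q p 0≤q = subst (ℚ._≤ p ℚ.+ _) (ℚ.+-identityʳ p) (ℚ.+-monoʳ-≤ p 0≤q)

^-positive : ∀ {q} n → 0ℚ ℚ.< q → 0ℚ ℚ.< q ^ n
^-positive zero    0<q = ℚ.positive⁻¹ 1ℚ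
^-positive (suc n) 0<q = *-positive 0<q (^-positive n 0<q)

^-mono-≤ : ∀ {p q} n → 0ℚ ℚ.< p → p ℚ.≤ q → p ^ n ℚ.≤ q ^ n
^-mono-≤ zero    0<p p≤q = ℚ.≤-refl
^-mono-≤ (suc n) 0<p p≤q = *-mono-≤-nonNeg
  (ℚ.<⇒≤ (^-positive n 0<p)) (ℚ.<⇒≤ (ℚ.<-≤-trans 0<p p≤q)) p≤q (^-mono-≤ n 0<p p≤q)

-- Split one factor off the right side: (t + 1)(t + 1)ⁿ = (t + 1)ⁿ + t(t + 1)ⁿ, and t(t + 1)ⁿ ≥
-- tⁿ⁺¹.
^-gap : ∀ {t} n → 0ℚ ℚ.< t → (t ℚ.+ 1ℚ) ^ n ℚ.+ t ^ suc n ℚ.≤ (t ℚ.+ 1ℚ) ^ suc n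
^-gap {t} n 0<t = ℚ.≤-trans
  (ℚ.+-monoʳ-≤ ((t ℚ.+ 1ℚ) ^ n)
    (ℚ.*-monoˡ-≤-nonNeg t {{ℚ.nonNegative (ℚ.<⇒≤ 0<t)}}
      (^-mono-≤ n 0<t (p≤p+q t (ℚ.<⇒≤ (ℚ.positive⁻¹ 1ℚ))))))
  (ℚ.≤-reflexive (solve 2 (λ t u → u :+ t :* u := (t :+ con 1ℚ) :* u) refl
    t ((t ℚ.+ 1ℚ) ^ n)))

∣p*inv∣*q : ∀ p {q} → 0ℚ ℚ.< q → ℚ.∣ p ℚ.* inv q ∣ ℚ.* q ≡ ℚ.∣ p ∣
∣p*inv∣*q p {q} 0<q = trans
  (cong (ℚ.∣ p ℚ.* inv q ∣ ℚ.*_) (sym (ℚ.0≤p⇒∣p∣≡p (ℚ.<⇒≤ 0<q))))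
  (trans (sym (ℚ.∣p*q∣≡∣p∣*∣q∣ (p ℚ.* inv q) q))
    (cong ℚ.∣_∣ (trans
      (solve 3 (λ p q i → p :* i :* q := p :* (q :* i)) refl p q (inv q))
      (trans (cong (p ℚ.*_) (inv-inverseʳ q (λ q≡0 → ℚ.<⇒≢ 0<q (sym q≡0))))
             (ℚ.*-identityʳ p)))))

-- The value at a rational q of the quotient E(x)/xʲ (j = k − 1), with count a
-- and with i in place of 1/ζ(rk).
errorQuotient : ℕ → ℚ → ℚ → ℚ → ℚ
errorQuotient j a i q = (a ℚ.- (+ 2 / 1 ℚ.* q) ^ suc j ℚ.* i) ℚ.* inv (q ^ j)

-- Both sides are multiplied by `G`, the larger of the two denominators. The numerators `A` and `B`
-- differ by the growth of the main term, which is at least `i * W` and hence at least `½ * G`.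
errorQuotient-jump : ∀ j a {i q} → ½ ℚ.≤ i → 0ℚ ℚ.< q →
  ½ ℚ.≤ ℚ.∣ errorQuotient j a i q ∣ ℚ.+ ℚ.∣ errorQuotient j a i (q ℚ.+ ½) ∣
errorQuotient-jump j a {i} {q} ½≤i 0<q = ℚ.*-cancelʳ-≤-pos G {{ℚ.positive 0<G}}
  (begin
    ½ ℚ.* G                                     ≤⟨ ℚ.*-monoʳ-≤-nonNeg G {{ℚ.nonNegative (ℚ.<⇒≤ 0<G)}} ½≤i ⟩
    i ℚ.* G                                     ≤⟨ ℚ.*-monoˡ-≤-nonNeg i {{ℚ.nonNegative 0≤i}} G≤W ⟩
    i ℚ.* W                                     ≡⟨ solve 3 (λ i w p → i :* w := (w :+ p) :* i :- p :* i) refl i W P ⟩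
    (W ℚ.+ P) ℚ.* i ℚ.- P ℚ.* i                 ≤⟨ ℚ.+-monoˡ-≤ (ℚ.- (P ℚ.* i)) (ℚ.*-monoʳ-≤-nonNeg i {{ℚ.nonNegative 0≤i}} W+P≤Q) ⟩
    -- The common count `a` cancels in the difference of the errors.
    Q ℚ.* i ℚ.- P ℚ.* i                         ≡⟨ solve 3 (λ a p q → q :- p := (a :- p) :- (a :- q)) refl a (P ℚ.* i) (Q ℚ.* i) ⟩
    A ℚ.- B                                     ≤⟨ p≤∣p∣ (A ℚ.- B) ⟩
    ℚ.∣ A ℚ.- B ∣                               ≤⟨ ℚ.∣p-q∣≤∣p∣+∣q∣ A B ⟩
    ℚ.∣ A ∣ ℚ.+ ℚ.∣ B ∣                         ≡⟨ sym (cong₂ ℚ._+_ (∣p*inv∣*q A 0<H) (∣p*inv∣*q B 0<G)) ⟩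
    u ℚ.* H ℚ.+ v ℚ.* G                         ≤⟨ ℚ.+-monoˡ-≤ (v ℚ.* G) (ℚ.*-monoˡ-≤-nonNeg u {{ℚ.∣-∣-nonNeg (errorQuotient j a i q)}} H≤G) ⟩
    u ℚ.* G ℚ.+ v ℚ.* G                         ≡⟨ sym (ℚ.*-distribʳ-+ G u v) ⟩
    (u ℚ.+ v) ℚ.* G                             ∎)
  where
  open ℚ.≤-Reasoning
  q′ = q ℚ.+ ½
  H = q ^ j
  G = q′ ^ j
  P = (+ 2 / 1 ℚ.* q) ^ suc j
  Q = (+ 2 / 1 ℚ.* q′) ^ suc j
  W = (+ 2 / 1 ℚ.* q′) ^ j
  A = a ℚ.- P ℚ.* i
  B = a ℚ.- Q ℚ.* i
  u = ℚ.∣ errorQuotient j a i q ∣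
  v = ℚ.∣ errorQuotient j a i q′ ∣

  0≤i : 0ℚ ℚ.≤ i
  0≤i = ℚ.≤-trans (ℚ.<⇒≤ (ℚ.positive⁻¹ ½)) ½≤i

  q≤q′ : q ℚ.≤ q′
  q≤q′ = p≤p+q q (ℚ.<⇒≤ (ℚ.positive⁻¹ ½))

  0<q′ : 0ℚ ℚ.< q′
  0<q′ = ℚ.<-≤-trans 0<q q≤q′

  0<H : 0ℚ ℚ.< H
  0<H = ^-positive j 0<q

  0<G : 0ℚ ℚ.< G
  0<G = ^-positive j 0<q′

  H≤G : H ℚ.≤ G
  H≤G = ^-mono-≤ j 0<q q≤q′

  G≤W : G ℚ.≤ W
  G≤W = ^-mono-≤ j 0<q′ (subst (q′ ℚ.≤_)
    (solve 1 (λ q → q :+ q := con (+ 2 / 1) :* q) refl q′)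
    (p≤p+q q′ (ℚ.<⇒≤ 0<q′)))

  W+P≤Q : W ℚ.+ P ℚ.≤ Q
  -- Moving q by ½ moves 2q by 1, so the gap of powers applies with t = 2q.
  W+P≤Q = subst (λ t → t ^ j ℚ.+ P ℚ.≤ t ^ suc j)
    (solve 1 (λ q → con (+ 2 / 1) :* q :+ con 1ℚ := con (+ 2 / 1) :* (q :+ con ½)) refl q)
    (^-gap j (*-positive (ℚ.positive⁻¹ (+ 2 / 1)) 0<q))

-- Every partial sum is at most `zetaUpper s 0`, which is 1 + 1. The index starts at 1 because the
-- empty sum is 0, and `inv` sends it to 0.
½≤inv-zetaSum : ∀ s → 1 ℕ.< s → ∀ {n} → 1 ≤ n → ½ ℚ.≤ inv (zetaSum s n)
½≤inv-zetaSum s 1<s {n} 1≤n = ℚ.*-cancelʳ-≤-pos Z {{ℚ.positive 0<Z}}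
  (ℚ.≤-trans (ℚ.*-monoˡ-≤-nonNeg ½ Z≤2)
    (ℚ.≤-reflexive (sym (trans (ℚ.*-comm (inv Z) Z)
      (inv-inverseʳ Z (λ Z≡0 → ℚ.<⇒≢ 0<Z (sym Z≡0)))))))
  where
  Z = zetaSum s n

  0<Z : 0ℚ ℚ.< Z
  0<Z = ℚ.<-≤-trans
    (ℚ.<-respʳ-≡ (sym (ℚ.+-identityˡ (reciprocalPower s 0)))
      (unitFraction-positive (1 ℕ.^ s) {{ℕ.m^n≢0 1 s}}))
    (zetaSum-mono s 1≤n)

  Z≤2 : Z ℚ.≤ + 2 / 1
  Z≤2 = ℚ.≤-trans (zetaSum-bounded s 1<s {0} 1≤n)
    (ℚ.+-monoˡ-≤ 1ℚ (ℚ.+-monoʳ-≤ 0ℚ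
      (unitFraction-antimono {1} {1 ℕ.^ s} {{_}} {{ℕ.m^n≢0 1 s}}
        (ℕ.≤-reflexive (sym (ℕ.^-zeroˡ s))))))

-- From rational approximations to real inequalities.

^ℝ-seq : ∀ x j n → seq (x ^ℝ j) n ≡ seq x n ^ j
^ℝ-seq x zero    n = refl
^ℝ-seq x (suc j) n = cong (seq x n ℚ.*_) (^ℝ-seq x j n)

fromℚ^#0 : ∀ {q} → 0ℚ ℚ.< q → ∀ j → (fromℚ q ^ℝ j) #0
fromℚ^#0 {q} 0<q j = inj₂ (q ^ j , ^-positive j 0<q , 0 , λ n _ →
  ℚ.≤-reflexive (trans (ℚ.+-identityˡ (q ^ j)) (sym (^ℝ-seq (fromℚ q) j n))))

-- Real arithmetic acts termwise, so only the powers need rewriting. As q is a constant sequence, n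
-- enters through the partial sum of ζ alone.
quotient-seq : ∀ r j 1<s q d g#0 n →
  seq (E r (suc j) 1<s (fromℚ q) d ÷ℝ (fromℚ q ^ℝ j) [ g#0 ]) n ≡
  errorQuotient j (+ V r (suc j) (fromℚ q) d / 1) (inv (zetaSum (r * suc j) n)) q
quotient-seq r j 1<s q d g#0 n = cong₂
  (λ s t → (+ V r (suc j) (fromℚ q) d / 1 ℚ.- s ℚ.* inv (zetaSum (r * suc j) n)) ℚ.* inv t)
  (^ℝ-seq (fromℕ 2 *ℝ fromℚ q) (suc j) n)
  (^ℝ-seq (fromℚ q) j n)

-- Beyond `N` any two terms differ by less than c/2, so a single term of size 2c keeps all later
-- ones above c + c/2, which leaves the margin that `<ℝ` demands.
large-seq : ∀ x {c} → 0ℚ ℚ.< c →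
  ∃[ N ] (∀ m → N ≤ m → c ℚ.+ c ℚ.≤ seq x m → fromℚ c <ℝ x)
large-seq x {c} 0<c =
  let N , close = cauchy x (half c) (half-positive 0<c)
  in N , λ m N≤m 2c≤xₘ → half c , half-positive 0<c , N , λ n N≤n → begin
    c ℚ.+ half c                  ≡⟨ solve 2 (λ c h → c :+ h := (c :+ (h :+ h)) :- h) refl c (half c) ⟩
    c ℚ.+ (half c ℚ.+ half c) ℚ.- half c
                                  ≡⟨ cong (λ t → c ℚ.+ t ℚ.- half c) (half+half c) ⟩
    c ℚ.+ c ℚ.- half c            ≤⟨ ℚ.+-mono-≤ 2c≤xₘ (ℚ.neg-antimono-≤ (ℚ.≤-trans
                                       (p≤∣p∣ (seq x m ℚ.- seq x n)) (ℚ.<⇒≤ (close m n N≤m N≤n)))) ⟩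
    seq x m ℚ.- (seq x m ℚ.- seq x n)
                                  ≡⟨ solve 2 (λ a b → a :- (a :- b) := b) refl (seq x m) (seq x n) ⟩
    seq x n                       ∎
  where open ℚ.≤-Reasoning

large-summand : ∀ {p q c d} → c ℚ.+ d ℚ.≤ p ℚ.+ q → c ℚ.≤ p ⊎ d ℚ.≤ q
large-summand {p} {q} {c} {d} c+d≤p+q with c ℚ.≤? p
... | yes c≤p = inj₁ c≤p
... | no  c≰p = inj₂ (ℚ.≮⇒≥ λ q<d →
  ℚ.<-irrefl refl (ℚ.<-≤-trans (ℚ.+-mono-< (ℚ.≰⇒> c≰p) q<d) c+d≤p+q))

-- The disjunction is decided by comparing rationals at one index `n`, chosen late enough for
-- `large-seq` to apply to whichever of x and y is found large.
<ℝ-large-summand : ∀ x y {c} → 0ℚ ℚ.< c → ∀ N →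
  (∀ n → N ≤ n → (c ℚ.+ c) ℚ.+ (c ℚ.+ c) ℚ.≤ seq x n ℚ.+ seq y n) →
  fromℚ c <ℝ x ⊎ fromℚ c <ℝ y
<ℝ-large-summand x y {c} 0<c N 4c≤ =
  let K , large-x = large-seq x 0<c
      L , large-y = large-seq y 0<c
      n = N ℕ.⊔ (K ℕ.⊔ L)
      K⊔L≤n = ℕ.m≤n⊔m N (K ℕ.⊔ L)
  in Sum.map (large-x n (ℕ.m⊔n≤o⇒m≤o K L K⊔L≤n)) (large-y n (ℕ.m⊔n≤o⇒n≤o K L K⊔L≤n))
       (large-summand (4c≤ n (ℕ.m≤m⊔n N (K ℕ.⊔ L))))

≤ℝ-fromℚ : ∀ X {B q} N → (∀ n → N ≤ n → ℚ.∣ seq X n ∣ ℚ.≤ B) → B ℚ.≤ q → X ≤ℝ fromℚ q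
≤ℝ-fromℚ X {B} {q} N bound B≤q (ε , 0<ε , M , h) = ℚ.<-irrefl refl
  (ℚ.<-≤-trans (ℚ.<-respˡ-≡ (ℚ.+-identityʳ q) (ℚ.+-monoʳ-< q 0<ε))
    (ℚ.≤-trans (h n (ℕ.m≤m⊔n M N))
      (ℚ.≤-trans (p≤∣p∣ (seq X n)) (ℚ.≤-trans (bound n (ℕ.m≤n⊔m M N)) B≤q))))
  where n = M ℕ.⊔ N

theorem4p1 : (r k : ℕ) → 1 ≤ r → 1 ≤ k → (3≤rk : 3 ≤ r * k) → k ≢ 1 →
    Ω (Domain r k) (E r k (<⇒≤ 3≤rk)) (λ x → x ^ℝ (k ∸ 1))
theorem4p1 r (suc j) 1≤r _ 3≤rk _ =
    fromℚ c
  , (c , 0<c , 0 , λ _ _ → ℚ.≤-reflexive (ℚ.+-identityˡ c))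
  , λ X →
    let B , _ , N , bound = eventually-bounded (cauchy X)
        m , B≤q = archimedean B
        q = + suc m / 1
        0<q = ℚ.positive⁻¹ q {{ℚ.normalize-pos (suc m) 1}}
        q≤q′ = p≤p+q q (ℚ.<⇒≤ (ℚ.positive⁻¹ ½))
        0<q′ = ℚ.<-≤-trans 0<q q≤q′
        q′<1+q = subst (q ℚ.+ ½ ℚ.<_) (fromℕ-suc (suc m)) (ℚ.+-monoʳ-< q ½<1)
        d  = floorDomain r (suc j) 1≤r (suc m) 0<q (ℚ.≤-refl , ℚ.≤-<-trans q≤q′ q′<1+q)
        d′ = floorDomain r (suc j) 1≤r (suc m) 0<q′ (q≤q′ , q′<1+q)
        -- The count at `d` may also be used at `d′`: both domains carry the list for the integer
        -- part `suc m`.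
        jump = λ n 1≤n → subst₂ (λ s t → ½ ℚ.≤ ℚ.∣ s ∣ ℚ.+ ℚ.∣ t ∣)
          (sym (quotient-seq r j 1<s q d (fromℚ^#0 0<q j) n))
          (sym (quotient-seq r j 1<s (q ℚ.+ ½) d′ (fromℚ^#0 0<q′ j) n))
          (errorQuotient-jump j (+ V r (suc j) (fromℚ q) d / 1) (½≤inv-zetaSum (r * suc j) 1<s 1≤n) 0<q)
    in [ (λ c< → fromℚ q , ≤ℝ-fromℚ X N bound B≤q , d , fromℚ^#0 0<q j , c<)
       , (λ c< → fromℚ (q ℚ.+ ½) , ≤ℝ-fromℚ X N bound (ℚ.≤-trans B≤q q≤q′)
               , d′ , fromℚ^#0 0<q′ j , c<)
       ]′ (<ℝ-large-summand
            ∣ E r (suc j) 1<s (fromℚ q) d ÷ℝ (fromℚ q ^ℝ j) [ fromℚ^#0 0<q j ] ∣ℝ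
            ∣ E r (suc j) 1<s (fromℚ (q ℚ.+ ½)) d′ ÷ℝ (fromℚ (q ℚ.+ ½) ^ℝ j) [ fromℚ^#0 0<q′ j ] ∣ℝ
            0<c 1 jump)
  where
  c : ℚ
  -- Four times `c` is the ½ of the jump: one factor 2 is lost in choosing the larger quotient, the
  -- other in passing from one approximation to the real number.
  c = + 1 / 8

  0<c : 0ℚ ℚ.< c
  0<c = ℚ.positive⁻¹ c

  1<s : 1 ℕ.< r * suc j
  1<s = <⇒≤ 3≤rk

  ½<1 : ½ ℚ.< 1ℚ
  ½<1 = ℚ.*<* (ℤ.+<+ (s≤s (s≤s z≤n)))
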